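{- Every term of the un-typed symmetric $\lambda\mu$-calculus is strongly normalizing for the $\mu\mu'$-reduction, i.e. no term has an infinite sequence of $\mu\mu'$-reduction steps.
   Context: Terms of the symmetric $\lambda\mu$-calculus are given by $\mathcal{T} ::= x \mid \lambda x\,\mathcal{T}\mid(\mathcal{T}\;\mathcal{T})\mid\mu\alpha\,\mathcal{T}\mid(\alpha\;\mathcal{T})$, where $x,y,\dots$ are $\lambda$-variables and $\alpha,\beta,\dots$ are $\mu$-variables; $\lambda x$ and $\mu\alpha$ are binders, terms are considered up to renaming of bound variables and all substitutions are capture-avoiding. $M[\alpha=_rN]$ (resp. $M[\alpha=_lN]$) is obtained from $M$ by replacing (recursively) each sub-term of the form $(\alpha\;U)$ by $(\alpha\;(U\;N))$ (resp. $(\alpha\;(N\;U))$). The $\mu\mu'$-reduction is the closure under all term constructors of: $(\mu\alpha\,M\;N)\triangleright_\mu\mu\alpha\,M[\alpha=_rN]$ and $(N\;\mu\alpha\,M)\triangleright_{\mu'}\mu\alpha\,M[\alpha=_lN]$. -}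

module Defs where

open import Data.Fin.Base using (Fin; zero; suc; lift)
open import Data.Fin.Properties using (_≟_)
open import Data.Nat.Base using (ℕ; suc)
open import Function.Base using (id)
open import Level using (0ℓ)
open import Relation.Binary.Core using (Rel)
open import Relation.Nullary.Decidable.Core using (yes; no)

private
  variable
    l l′ m m′ : ℕ

-- Terms up to renaming of bound variables, as well-scoped de Bruijn terms:
-- Term l m has its free λ-variables in Fin l and its free μ-variables in Fin m.
-- The two kinds of variables are indexed independently, so ƛ binds only in l
-- and μ only in m.  The term (α U) is written ⟨ α ⟩ U.

infixl 7 _·_
infixr 6 ƛ_ μ_ ⟨_⟩_

data Term (l m : ℕ) : Set where
  var  : Fin l → Term l m
  ƛ_   : Term (suc l) m → Term l m
  _·_  : Term l m → Term l m → Term l m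
  μ_   : Term l (suc m) → Term l m
  ⟨_⟩_ : Fin m → Term l m → Term l m

rename : (Fin l → Fin l′) → (Fin m → Fin m′) → Term l m → Term l′ m′
rename ρ θ (var x)     = var (ρ x)
rename ρ θ (ƛ M)       = ƛ rename (lift 1 ρ) θ M
rename ρ θ (M · N)     = rename ρ θ M · rename ρ θ N
rename ρ θ (μ M)       = μ rename ρ (lift 1 θ) M
rename ρ θ (⟨ α ⟩ M)   = ⟨ θ α ⟩ rename ρ θ M

wkλ : Term l m → Term (suc l) m
wkλ = rename suc id

wkμ : Term l m → Term l (suc m)
wkμ = rename id suc

-- α stays in scope: it still occurs in the result.  N is inserted as it is, so
-- any occurrence of α in N itself is left alone.

infix 8 _[_=ᵣ_] _[_=ₗ_]

_[_=ᵣ_] : Term l m → Fin m → Term l m → Term l m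
(var x)   [ α =ᵣ N ] = var x
(ƛ M)     [ α =ᵣ N ] = ƛ (M [ α =ᵣ wkλ N ])
(M · M′)  [ α =ᵣ N ] = M [ α =ᵣ N ] · M′ [ α =ᵣ N ]
(μ M)     [ α =ᵣ N ] = μ (M [ suc α =ᵣ wkμ N ])
(⟨ β ⟩ U) [ α =ᵣ N ] with β ≟ α
... | yes _ = ⟨ β ⟩ (U [ α =ᵣ N ] · N)
... | no  _ = ⟨ β ⟩ (U [ α =ᵣ N ])

_[_=ₗ_] : Term l m → Fin m → Term l m → Term l m
(var x)   [ α =ₗ N ] = var x
(ƛ M)     [ α =ₗ N ] = ƛ (M [ α =ₗ wkλ N ])
(M · M′)  [ α =ₗ N ] = M [ α =ₗ N ] · M′ [ α =ₗ N ]
(μ M)     [ α =ₗ N ] = μ (M [ suc α =ₗ wkμ N ])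
(⟨ β ⟩ U) [ α =ₗ N ] with β ≟ α
... | yes _ = ⟨ β ⟩ (N · U [ α =ₗ N ])
... | no  _ = ⟨ β ⟩ (U [ α =ₗ N ])

-- In both contraction rules N is weakened, since the variable bound by μ must
-- not be free in it.

infix 4 _▷_

data _▷_ {l m : ℕ} : Rel (Term l m) 0ℓ where
  red-μ  : ∀ {M N} → (μ M) · N ▷ μ (M [ zero =ᵣ wkμ N ])
  red-μ′ : ∀ {M N} → N · (μ M) ▷ μ (M [ zero =ₗ wkμ N ])
  ξ-ƛ    : ∀ {M M′} → M ▷ M′ → ƛ M ▷ ƛ M′
  ξ-·ₗ   : ∀ {M M′ N} → M ▷ M′ → M · N ▷ M′ · N
  ξ-·ᵣ   : ∀ {M N N′} → N ▷ N′ → M · N ▷ M · N′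
  ξ-μ    : ∀ {M M′} → M ▷ M′ → μ M ▷ μ M′
  ξ-⟨⟩   : ∀ {α M M′} → M ▷ M′ → ⟨ α ⟩ M ▷ ⟨ α ⟩ M′

{-# OPTIONS --safe #-}
module Submission where

-- It suffices that M · N is strongly normalizing when M and N are.  Order terms
-- by ≺, the transitive closure of "reduct or immediate subterm"; ≺ is accessible
-- at strongly normalizing terms.  Call an argument X compatible with U if W σ
-- applied to X is strongly normalizing for all W ≺ U and all substitutions σ
-- inserting only arguments compatible with W: a definition by recursion on U.
-- If σ inserts only arguments compatible with U, then U σ is strongly
-- normalizing, by induction on U along ≺: an application (A B) σ can only expose
-- a head μ that (A B) itself exposes, so its contractum is an instance of a term
-- ≺ A B.  Finally U σ · V τ is strongly normalizing, by induction on the pair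
-- (U , V), for σ inserting on the right, τ on the left: contracting a head
-- μ of U σ extends σ by V τ, which is compatible with U by the induction hypothesis
-- for the pairs (W , V) with W ≺ U; the other side is symmetric.

open import Defs
open import Data.Fin.Base using (Fin; zero; suc; lift)
open import Data.Fin.Properties using (_≟_)
open import Data.List.Base using (List; []; _∷_; _++_; map)
open import Data.List.Properties using (map-∘; map-++; map-cong; ++-identityʳ)
open import Data.Nat.Base using (ℕ; suc)
open import Data.Product.Base using (_×_; _,_; ∃-syntax; map₂)
open import Data.Sum.Base as Sum using (_⊎_; inj₁; inj₂)
open import Function.Base using (flip; id; _∘_)
open import Induction.InfiniteDescent using (InfiniteDescendingSequenceFrom)
open import Induction.WellFounded using (Acc; acc; acc-inverse)
open import Relation.Binary.Construct.Closure.ReflexiveTransitive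
  using (Star; ε; _◅_; _◅◅_; gmap)
open import Relation.Binary.Construct.Closure.Transitive
  using (TransClosure; accessible; [_]; _∷_)
  renaming (_++_ to _++⁺_)
open import Relation.Binary.PropositionalEquality hiding ([_])
open import Relation.Binary.Rewriting using (StronglyNormalizing)
open import Relation.Nullary.Negation.Core using (¬_; contradiction)
open import Relation.Nullary.Decidable.Core using (yes; no)

private
  variable
    l l′ l″ m m′ m″ : ℕ

-- Frames and parallel structural substitution.

data Side : Set where
  left right : Side

Frame : ℕ → ℕ → Set
Frame l m = Side × Term l m

app : Side → Term l m → Term l m → Term l m
app left  M N = N · M
app right M N = M · N

plug : Term l m → List (Frame l m) → Term l m
plug M []             = M
plug M ((s , N) ∷ fs) = plug (app s M N) fs

mapF : (Term l m → Term l′ m′) → List (Frame l m) → List (Frame l′ m′)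
mapF f = map (map₂ f)

-- Parallel structural substitution: each (α U) becomes
-- ⟨ ren-μ α ⟩ plug U (frames α), so that renamings, both substitutions of the
-- calculus and their composites are all of this form.
record Subst (l m l′ m′ : ℕ) : Set where
  constructor mkSubst
  field
    ren-λ  : Fin l → Fin l′
    ren-μ  : Fin m → Fin m′
    frames : Fin m → List (Frame l′ m′)

open Subst

ren : (Fin l → Fin l′) → (Fin m → Fin m′) → Subst l m l′ m′
ren ρ θ = mkSubst ρ θ (λ _ → [])

idS : Subst l m l m
idS = ren id id

lift-λ : Subst l m l′ m′ → Subst (suc l) m (suc l′) m′
lift-λ σ = mkSubst (lift 1 (ren-λ σ)) (ren-μ σ) (mapF wkλ ∘ frames σ)

infixr 5 _▸_

-- Passes below a `μ` and attaches `fs` to its variable in the same move. The variable stays bound,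
-- as it still names the subterms that receive an argument; `lift-μ` attaches nothing.
_▸_ : List (Frame l′ (suc m′)) → Subst l m l′ m′ → Subst l (suc m) l′ (suc m′)
ren-λ  (fs ▸ σ)         = ren-λ σ
ren-μ  (fs ▸ σ)         = lift 1 (ren-μ σ)
frames (fs ▸ σ) zero    = fs
frames (fs ▸ σ) (suc α) = mapF wkμ (frames σ α)

lift-μ : Subst l m l′ m′ → Subst l (suc m) l′ (suc m′)
lift-μ σ = [] ▸ σ

infixl 8 _⟦_⟧

_⟦_⟧ : Term l m → Subst l m l′ m′ → Term l′ m′
var x     ⟦ σ ⟧ = var (ren-λ σ x)
(ƛ M)     ⟦ σ ⟧ = ƛ (M ⟦ lift-λ σ ⟧)
(M · N)   ⟦ σ ⟧ = M ⟦ σ ⟧ · N ⟦ σ ⟧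
(μ M)     ⟦ σ ⟧ = μ (M ⟦ lift-μ σ ⟧)
(⟨ α ⟩ M) ⟦ σ ⟧ = ⟨ ren-μ σ α ⟩ plug (M ⟦ σ ⟧) (frames σ α)

infix 4 _≈_

-- Substitutions consist of functions, so they are compared pointwise; `⟦⟧-cong` then stands in for
-- function extensionality.
record _≈_ (σ τ : Subst l m l′ m′) : Set where
  constructor mk≈
  field
    ≈-λ : ∀ x → ren-λ σ x ≡ ren-λ τ x
    ≈-μ : ∀ α → ren-μ σ α ≡ ren-μ τ α
    ≈-f : ∀ α → frames σ α ≡ frames τ α

open _≈_

lift₁-cong : {f g : Fin l → Fin l′} → (∀ x → f x ≡ g x) → ∀ x → lift 1 f x ≡ lift 1 g x
lift₁-cong e zero    = refl
lift₁-cong e (suc x) = cong suc (e x)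

lift-λ-cong : {σ τ : Subst l m l′ m′} → σ ≈ τ → lift-λ σ ≈ lift-λ τ
lift-λ-cong e = mk≈ (lift₁-cong (≈-λ e)) (≈-μ e) (cong (mapF wkλ) ∘ ≈-f e)

lift-μ-cong : {σ τ : Subst l m l′ m′} → σ ≈ τ → lift-μ σ ≈ lift-μ τ
lift-μ-cong e = mk≈ (≈-λ e) (lift₁-cong (≈-μ e))
  λ { zero → refl ; (suc α) → cong (mapF wkμ) (≈-f e α) }

⟦⟧-cong : {σ τ : Subst l m l′ m′} → σ ≈ τ → ∀ M → M ⟦ σ ⟧ ≡ M ⟦ τ ⟧
⟦⟧-cong e (var x)   = cong var (≈-λ e x)
⟦⟧-cong e (ƛ M)     = cong ƛ_ (⟦⟧-cong (lift-λ-cong e) M)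
⟦⟧-cong e (M · N)   = cong₂ _·_ (⟦⟧-cong e M) (⟦⟧-cong e N)
⟦⟧-cong e (μ M)     = cong μ_ (⟦⟧-cong (lift-μ-cong e) M)
⟦⟧-cong e (⟨ α ⟩ M) =
  cong₂ ⟨_⟩_ (≈-μ e α) (cong₂ plug (⟦⟧-cong e M) (≈-f e α))

lift-λ-ren : {ρ : Fin l → Fin l′} {θ : Fin m → Fin m′} →
             lift-λ (ren ρ θ) ≈ ren (lift 1 ρ) θ
lift-λ-ren = mk≈ (λ _ → refl) (λ _ → refl) (λ _ → refl)

lift-μ-ren : {ρ : Fin l → Fin l′} {θ : Fin m → Fin m′} →
             lift-μ (ren ρ θ) ≈ ren ρ (lift 1 θ)
lift-μ-ren = mk≈ (λ _ → refl) (λ _ → refl) λ { zero → refl ; (suc _) → refl }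

⟦ren⟧ : (ρ : Fin l → Fin l′) (θ : Fin m → Fin m′) → ∀ M → M ⟦ ren ρ θ ⟧ ≡ rename ρ θ M
⟦ren⟧ ρ θ (var x)   = refl
⟦ren⟧ ρ θ (ƛ M)     = cong ƛ_ (trans (⟦⟧-cong lift-λ-ren M) (⟦ren⟧ _ θ M))
⟦ren⟧ ρ θ (M · N)   = cong₂ _·_ (⟦ren⟧ ρ θ M) (⟦ren⟧ ρ θ N)
⟦ren⟧ ρ θ (μ M)     = cong μ_ (trans (⟦⟧-cong lift-μ-ren M) (⟦ren⟧ ρ _ M))
⟦ren⟧ ρ θ (⟨ α ⟩ M) = cong ⟨ θ α ⟩_ (⟦ren⟧ ρ θ M)

lift₁-id : {f : Fin l → Fin l} → (∀ x → f x ≡ x) → ∀ x → lift 1 f x ≡ x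
lift₁-id e zero    = refl
lift₁-id e (suc x) = cong suc (e x)

⟦id⟧ : (M : Term l m) → M ⟦ idS ⟧ ≡ M
⟦id⟧ = go idS (mk≈ (λ _ → refl) (λ _ → refl) (λ _ → refl))
  where
  -- Lifting `idS` gives `idS` only pointwise, so the induction ranges over every `σ ≈ idS`.
  go : (σ : Subst l m l m) → σ ≈ idS → ∀ M → M ⟦ σ ⟧ ≡ M
  go σ e (var x)   = cong var (≈-λ e x)
  go σ e (ƛ M)     =
    cong ƛ_ (go _ (mk≈ (lift₁-id (≈-λ e)) (≈-μ e) (cong (mapF wkλ) ∘ ≈-f e)) M)
  go σ e (M · N)   = cong₂ _·_ (go σ e M) (go σ e N)
  go σ e (μ M)     = cong μ_ (go _ (mk≈ (≈-λ e) (lift₁-id (≈-μ e))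
    λ { zero → refl ; (suc α) → cong (mapF wkμ) (≈-f e α) }) M)
  go σ e (⟨ α ⟩ M) = cong₂ ⟨_⟩_ (≈-μ e α) (cong₂ plug (go σ e M) (≈-f e α))

-- Composition of substitutions.

infixl 6 _⨟_

-- The frames of `σ`, instantiated by `τ`, stay innermost; around them go those that `τ` attaches to
-- the new name of `α`.
_⨟_ : Subst l m l′ m′ → Subst l′ m′ l″ m″ → Subst l m l″ m″
ren-λ  (σ ⨟ τ)   = ren-λ τ ∘ ren-λ σ
ren-μ  (σ ⨟ τ)   = ren-μ τ ∘ ren-μ σ
frames (σ ⨟ τ) α = mapF (_⟦ τ ⟧) (frames σ α) ++ frames τ (ren-μ σ α)

lift₁-∘ : (f : Fin l → Fin l′) (g : Fin l′ → Fin l″) →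
          ∀ x → lift 1 g (lift 1 f x) ≡ lift 1 (g ∘ f) x
lift₁-∘ f g zero    = refl
lift₁-∘ f g (suc x) = refl

plug-++ : ∀ (M : Term l m) fs gs → plug M (fs ++ gs) ≡ plug (plug M fs) gs
plug-++ M []             gs = refl
plug-++ M ((s , N) ∷ fs) gs = plug-++ (app s M N) fs gs

⟦⟧-app : ∀ s (M N : Term l m) (σ : Subst l m l′ m′) →
         app s M N ⟦ σ ⟧ ≡ app s (M ⟦ σ ⟧) (N ⟦ σ ⟧)
⟦⟧-app left  M N σ = refl
⟦⟧-app right M N σ = refl

⟦⟧-plug : ∀ (M : Term l m) fs (σ : Subst l m l′ m′) →
          plug M fs ⟦ σ ⟧ ≡ plug (M ⟦ σ ⟧) (mapF (_⟦ σ ⟧) fs)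
⟦⟧-plug M []             σ = refl
⟦⟧-plug M ((s , N) ∷ fs) σ = trans (⟦⟧-plug (app s M N) fs σ)
  (cong (λ K → plug K (mapF (_⟦ σ ⟧) fs)) (⟦⟧-app s M N σ))

rename-⟦⟧ : (ρ : Fin l → Fin l′) (θ : Fin m → Fin m′) (τ : Subst l′ m′ l″ m″) →
            ∀ M → rename ρ θ M ⟦ τ ⟧ ≡ M ⟦ ren ρ θ ⨟ τ ⟧
rename-⟦⟧ ρ θ τ (var x)   = refl
rename-⟦⟧ ρ θ τ (ƛ M)     = cong ƛ_ (trans (rename-⟦⟧ _ _ _ M)
  (⟦⟧-cong (mk≈ (lift₁-∘ ρ (ren-λ τ)) (λ _ → refl) (λ _ → refl)) M))
rename-⟦⟧ ρ θ τ (M · N)   = cong₂ _·_ (rename-⟦⟧ ρ θ τ M) (rename-⟦⟧ ρ θ τ N)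
rename-⟦⟧ ρ θ τ (μ M)     = cong μ_ (trans (rename-⟦⟧ _ _ _ M)
  (⟦⟧-cong (mk≈ (λ _ → refl) (lift₁-∘ θ (ren-μ τ)) λ { zero → refl ; (suc _) → refl }) M))
rename-⟦⟧ ρ θ τ (⟨ α ⟩ M) =
  cong (λ K → ⟨ ren-μ τ (θ α) ⟩ plug K (frames τ (θ α))) (rename-⟦⟧ ρ θ τ M)

mapF-square : {f : Term l m → Term l′ m′} {g : Term l′ m′ → Term l″ m″}
              {l‴ m‴ : ℕ} {f′ : Term l m → Term l‴ m‴} {g′ : Term l‴ m‴ → Term l″ m″} →
              (∀ M → g (f M) ≡ g′ (f′ M)) → ∀ fs → mapF g (mapF f fs) ≡ mapF g′ (mapF f′ fs)
mapF-square e []             = refl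
mapF-square e ((s , M) ∷ fs) = cong₂ _∷_ (cong (s ,_) (e M)) (mapF-square e fs)

rename-rename : ∀ {l₀ m₀} (ρ : Fin l → Fin l′) (θ : Fin m → Fin m′)
                (ρ′ : Fin l₀ → Fin l) (θ′ : Fin m₀ → Fin m) →
                ∀ M → rename ρ θ (rename ρ′ θ′ M) ≡ rename (ρ ∘ ρ′) (θ ∘ θ′) M
rename-rename ρ θ ρ′ θ′ M = begin
  rename ρ θ (rename ρ′ θ′ M)   ≡⟨ ⟦ren⟧ ρ θ _ ⟨
  rename ρ′ θ′ M ⟦ ren ρ θ ⟧    ≡⟨ rename-⟦⟧ ρ′ θ′ _ M ⟩
  M ⟦ ren (ρ ∘ ρ′) (θ ∘ θ′) ⟧   ≡⟨ ⟦ren⟧ _ _ M ⟩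
  rename (ρ ∘ ρ′) (θ ∘ θ′) M    ∎
  where open ≡-Reasoning

infixl 6 _⨾_

-- Composition with a renaming comes first: the general law `⟦⟧-⟦⟧` needs substitution to commute
-- with weakening, which is derived from this case.
_⨾_ : ∀ {l₀ m₀} → Subst l₀ m₀ l m → (Fin l → Fin l′) × (Fin m → Fin m′) → Subst l₀ m₀ l′ m′
σ ⨾ (ρ , θ) = mkSubst (ρ ∘ ren-λ σ) (θ ∘ ren-μ σ) (mapF (rename ρ θ) ∘ frames σ)

rename-app : ∀ (ρ : Fin l → Fin l′) (θ : Fin m → Fin m′) s M N →
             rename ρ θ (app s M N) ≡ app s (rename ρ θ M) (rename ρ θ N)
rename-app ρ θ left  M N = refl
rename-app ρ θ right M N = refl

rename-plug : ∀ (ρ : Fin l → Fin l′) (θ : Fin m → Fin m′) M fs →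
              rename ρ θ (plug M fs) ≡ plug (rename ρ θ M) (mapF (rename ρ θ) fs)
rename-plug ρ θ M []             = refl
rename-plug ρ θ M ((s , N) ∷ fs) = trans (rename-plug ρ θ (app s M N) fs)
  (cong (λ K → plug K (mapF (rename ρ θ) fs)) (rename-app ρ θ s M N))

rename-⟦⟧ʳ : ∀ {l₀ m₀} (σ : Subst l₀ m₀ l m) (ρ : Fin l → Fin l′) (θ : Fin m → Fin m′) →
             ∀ M → rename ρ θ (M ⟦ σ ⟧) ≡ M ⟦ σ ⨾ (ρ , θ) ⟧
rename-⟦⟧ʳ σ ρ θ (var x)   = refl
rename-⟦⟧ʳ σ ρ θ (ƛ M)     = cong ƛ_ (trans (rename-⟦⟧ʳ _ _ θ M)
  (⟦⟧-cong (mk≈ (lift₁-∘ (ren-λ σ) ρ) (λ _ → refl) (mapF-square wkλ-rename ∘ frames σ)) M))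
  where
  wkλ-rename : ∀ N → rename (lift 1 ρ) θ (wkλ N) ≡ wkλ (rename ρ θ N)
  wkλ-rename N = trans (rename-rename _ _ suc id N) (sym (rename-rename suc id ρ θ N))
rename-⟦⟧ʳ σ ρ θ (M · N)   = cong₂ _·_ (rename-⟦⟧ʳ σ ρ θ M) (rename-⟦⟧ʳ σ ρ θ N)
rename-⟦⟧ʳ σ ρ θ (μ M)     = cong μ_ (trans (rename-⟦⟧ʳ _ ρ _ M)
  (⟦⟧-cong (mk≈ (λ _ → refl) (lift₁-∘ (ren-μ σ) θ)
    λ { zero → refl ; (suc α) → mapF-square wkμ-rename (frames σ α) }) M))
  where
  wkμ-rename : ∀ N → rename ρ (lift 1 θ) (wkμ N) ≡ wkμ (rename ρ θ N)
  wkμ-rename N = trans (rename-rename _ _ id suc N) (sym (rename-rename id suc ρ θ N))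
rename-⟦⟧ʳ σ ρ θ (⟨ α ⟩ M) = cong ⟨ _ ⟩_ (trans (rename-plug ρ θ (M ⟦ σ ⟧) (frames σ α))
  (cong (λ K → plug K (mapF (rename ρ θ) (frames σ α))) (rename-⟦⟧ʳ σ ρ θ M)))

wkλ-⟦⟧ : (τ : Subst l m l′ m′) → ∀ M → wkλ M ⟦ lift-λ τ ⟧ ≡ wkλ (M ⟦ τ ⟧)
wkλ-⟦⟧ τ M = trans (rename-⟦⟧ suc id (lift-λ τ) M) (sym (rename-⟦⟧ʳ τ suc id M))

-- The variable carrying `fs` does not occur in a weakened term.
wkμ-▸-⟦⟧ : ∀ fs (τ : Subst l m l′ m′) → ∀ M → wkμ M ⟦ fs ▸ τ ⟧ ≡ wkμ (M ⟦ τ ⟧)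
wkμ-▸-⟦⟧ fs τ M = trans (rename-⟦⟧ id suc (fs ▸ τ) M) (sym (rename-⟦⟧ʳ τ id suc M))

lift-λ-⨟ : (σ : Subst l m l′ m′) (τ : Subst l′ m′ l″ m″) →
           lift-λ σ ⨟ lift-λ τ ≈ lift-λ (σ ⨟ τ)
lift-λ-⨟ σ τ = mk≈ (lift₁-∘ (ren-λ σ) (ren-λ τ)) (λ _ → refl) λ α →
  trans (cong (_++ _) (mapF-square (wkλ-⟦⟧ τ) (frames σ α)))
        (sym (map-++ _ (mapF (_⟦ τ ⟧) (frames σ α)) (frames τ (ren-μ σ α))))

lift-μ-⨟ : (σ : Subst l m l′ m′) (τ : Subst l′ m′ l″ m″) →
           lift-μ σ ⨟ lift-μ τ ≈ lift-μ (σ ⨟ τ)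
lift-μ-⨟ σ τ = mk≈ (λ _ → refl) (lift₁-∘ (ren-μ σ) (ren-μ τ)) λ
  { zero    → refl
  ; (suc α) → trans (cong (_++ _) (mapF-square (wkμ-▸-⟦⟧ [] τ) (frames σ α)))
        (sym (map-++ _ (mapF (_⟦ τ ⟧) (frames σ α)) (frames τ (ren-μ σ α)))) }

⟦⟧-⟦⟧ : (σ : Subst l m l′ m′) (τ : Subst l′ m′ l″ m″) →
        ∀ M → M ⟦ σ ⟧ ⟦ τ ⟧ ≡ M ⟦ σ ⨟ τ ⟧
⟦⟧-⟦⟧ σ τ (var x)   = refl
⟦⟧-⟦⟧ σ τ (ƛ M)     = cong ƛ_ (trans (⟦⟧-⟦⟧ _ _ M) (⟦⟧-cong (lift-λ-⨟ σ τ) M))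
⟦⟧-⟦⟧ σ τ (M · N)   = cong₂ _·_ (⟦⟧-⟦⟧ σ τ M) (⟦⟧-⟦⟧ σ τ N)
⟦⟧-⟦⟧ σ τ (μ M)     = cong μ_ (trans (⟦⟧-⟦⟧ _ _ M) (⟦⟧-cong (lift-μ-⨟ σ τ) M))
⟦⟧-⟦⟧ σ τ (⟨ α ⟩ M) = cong ⟨ _ ⟩_ (begin
  plug (plug (M ⟦ σ ⟧) fs ⟦ τ ⟧) gs    ≡⟨ cong (flip plug gs) (⟦⟧-plug _ fs τ) ⟩
  plug (plug (M ⟦ σ ⟧ ⟦ τ ⟧) fs′) gs   ≡⟨ plug-++ _ fs′ gs ⟨
  plug (M ⟦ σ ⟧ ⟦ τ ⟧) (fs′ ++ gs)     ≡⟨ cong (flip plug (fs′ ++ gs)) (⟦⟧-⟦⟧ σ τ M) ⟩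
  plug (M ⟦ σ ⨟ τ ⟧) (fs′ ++ gs)       ∎)
  where
  open ≡-Reasoning
  fs  = frames σ α
  fs′ = mapF (_⟦ τ ⟧) fs
  gs  = frames τ (ren-μ σ α)

-- Contraction as a substitution.

infix 8 _[_≔_]

-- A common form for the bodies of both contracta, `right` for `red-μ` and `left` for `red-μ′`.
_[_≔_] : Term l (suc m) → Side → Term l m → Term l (suc m)
M [ s ≔ N ] = M ⟦ ((s , wkμ N) ∷ []) ▸ idS ⟧

≔-⟦⟧ : ∀ M s N (σ : Subst l m l′ m′) →
       M [ s ≔ N ] ⟦ lift-μ σ ⟧ ≡ M ⟦ ((s , wkμ (N ⟦ σ ⟧)) ∷ []) ▸ σ ⟧
≔-⟦⟧ M s N σ = trans (⟦⟧-⟦⟧ _ (lift-μ σ) M) (⟦⟧-cong (mk≈ (λ _ → refl)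
  (λ { zero → refl ; (suc _) → refl })
  λ { zero → cong (λ K → (s , K) ∷ []) (wkμ-▸-⟦⟧ [] σ N) ; (suc _) → refl }) M)

-- Here `N` comes from outside `σ`: contracting a head `μ` of an instance amounts to extending the
-- substitution by one frame.
⟦⟧-≔ : ∀ M s N (σ : Subst l m l′ m′) →
       M ⟦ lift-μ σ ⟧ [ s ≔ N ] ≡ M ⟦ ((s , wkμ N) ∷ []) ▸ σ ⟧
⟦⟧-≔ M s N σ = trans (⟦⟧-⟦⟧ (lift-μ σ) _ M) (⟦⟧-cong (mk≈ (λ _ → refl)
  (λ { zero → refl ; (suc _) → refl })
  λ { zero → refl
    ; (suc α) → trans (++-identityʳ _) (trans (sym (map-∘ (frames σ α)))
        (map-cong (λ (t , K) → cong (t ,_) (wkμ-idS K)) (frames σ α))) }) M)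
  where
  wkμ-idS : ∀ K → wkμ K ⟦ ((s , wkμ N) ∷ []) ▸ idS ⟧ ≡ wkμ K
  wkμ-idS K = trans (wkμ-▸-⟦⟧ _ idS K) (cong wkμ (⟦id⟧ K))

-- Below binders the inserting substitution keeps its shape only pointwise, so the comparison with
-- `_[_=ᵣ_]` and `_[_=ₗ_]` is made for every substitution with this behaviour.
record IsPoint (α : Fin m) (s : Side) (N : Term l m) (σ : Subst l m l m) : Set where
  constructor mkPoint
  field
    at-λ : ∀ x → ren-λ σ x ≡ x
    at-μ : ∀ β → ren-μ σ β ≡ β
    at-≡ : frames σ α ≡ (s , N) ∷ []
    at-≢ : ∀ β → β ≢ α → frames σ β ≡ []

open IsPoint

lift-λ-point : ∀ {α : Fin m} {s} {N : Term l m} {σ} →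
               IsPoint α s N σ → IsPoint α s (wkλ N) (lift-λ σ)
lift-λ-point p = mkPoint (lift₁-id (at-λ p)) (at-μ p)
  (cong (mapF wkλ) (at-≡ p)) (λ β β≢α → cong (mapF wkλ) (at-≢ p β β≢α))

lift-μ-point : ∀ {α : Fin m} {s} {N : Term l m} {σ} →
               IsPoint α s N σ → IsPoint (suc α) s (wkμ N) (lift-μ σ)
lift-μ-point p = mkPoint (at-λ p) (lift₁-id (at-μ p)) (cong (mapF wkμ) (at-≡ p))
  λ { zero _ → refl ; (suc β) β≢α → cong (mapF wkμ) (at-≢ p β (β≢α ∘ cong suc)) }

=ᵣ-point : ∀ (M : Term l m) {α N σ} → IsPoint α right N σ → M [ α =ᵣ N ] ≡ M ⟦ σ ⟧
=ᵣ-point (var x)   p = cong var (sym (at-λ p x))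
=ᵣ-point (ƛ M)     p = cong ƛ_ (=ᵣ-point M (lift-λ-point p))
=ᵣ-point (M · N)   p = cong₂ _·_ (=ᵣ-point M p) (=ᵣ-point N p)
=ᵣ-point (μ M)     p = cong μ_ (=ᵣ-point M (lift-μ-point p))
=ᵣ-point (⟨ β ⟩ M) {α} p with β ≟ α
... | yes refl = cong₂ ⟨_⟩_ (sym (at-μ p β))
                   (trans (cong (_· _) (=ᵣ-point M p)) (cong (plug _) (sym (at-≡ p))))
... | no  β≢α  = cong₂ ⟨_⟩_ (sym (at-μ p β))
                   (trans (=ᵣ-point M p) (cong (plug _) (sym (at-≢ p β β≢α))))

=ₗ-point : ∀ (M : Term l m) {α N σ} → IsPoint α left N σ → M [ α =ₗ N ] ≡ M ⟦ σ ⟧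
=ₗ-point (var x)   p = cong var (sym (at-λ p x))
=ₗ-point (ƛ M)     p = cong ƛ_ (=ₗ-point M (lift-λ-point p))
=ₗ-point (M · N)   p = cong₂ _·_ (=ₗ-point M p) (=ₗ-point N p)
=ₗ-point (μ M)     p = cong μ_ (=ₗ-point M (lift-μ-point p))
=ₗ-point (⟨ β ⟩ M) {α} p with β ≟ α
... | yes refl = cong₂ ⟨_⟩_ (sym (at-μ p β))
                   (trans (cong (_ ·_) (=ₗ-point M p)) (cong (plug _) (sym (at-≡ p))))
... | no  β≢α  = cong₂ ⟨_⟩_ (sym (at-μ p β))
                   (trans (=ₗ-point M p) (cong (plug _) (sym (at-≢ p β β≢α))))

≔-point : ∀ s (N : Term l m) → IsPoint zero s (wkμ N) (((s , wkμ N) ∷ []) ▸ idS)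
≔-point s N = mkPoint (λ _ → refl) (lift₁-id (λ _ → refl)) refl
  λ { zero 0≢0 → contradiction refl 0≢0 ; (suc _) _ → refl }

=ᵣ-≔ : ∀ M (N : Term l m) → M [ zero =ᵣ wkμ N ] ≡ M [ right ≔ N ]
=ᵣ-≔ M N = =ᵣ-point M (≔-point right N)

=ₗ-≔ : ∀ M (N : Term l m) → M [ zero =ₗ wkμ N ] ≡ M [ left ≔ N ]
=ₗ-≔ M N = =ₗ-point M (≔-point left N)

-- Reduction and substitution.

infix 4 _▷*_

_▷*_ : Term l m → Term l m → Set
_▷*_ = Star _▷_

▷-contract : ∀ s M (N : Term l m) {K} → M [ s ≔ N ] ≡ K → app s (μ M) N ▷ μ K
▷-contract left  M N refl = subst (λ K → N · (μ M) ▷ μ K) (=ₗ-≔ M N) red-μ′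
▷-contract right M N refl = subst (λ K → (μ M) · N ▷ μ K) (=ᵣ-≔ M N) red-μ

▷-appˡ : ∀ s {M M′} {N : Term l m} → M ▷ M′ → app s M N ▷ app s M′ N
▷-appˡ left  = ξ-·ᵣ
▷-appˡ right = ξ-·ₗ

▷-appʳ : ∀ s {M N N′ : Term l m} → N ▷ N′ → app s M N ▷ app s M N′
▷-appʳ left  = ξ-·ₗ
▷-appʳ right = ξ-·ᵣ

▷-plug : ∀ {M M′ : Term l m} fs → M ▷ M′ → plug M fs ▷ plug M′ fs
▷-plug []             r = r
▷-plug ((s , _) ∷ fs) r = ▷-plug fs (▷-appˡ s r)

≔-⟦⟧-comm : ∀ M s N (σ : Subst l m l′ m′) →
            M ⟦ lift-μ σ ⟧ [ s ≔ N ⟦ σ ⟧ ] ≡ M [ s ≔ N ] ⟦ lift-μ σ ⟧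
≔-⟦⟧-comm M s N σ = trans (⟦⟧-≔ M s (N ⟦ σ ⟧) σ) (sym (≔-⟦⟧ M s N σ))

▷-⟦⟧ : ∀ {M M′ : Term l m} (σ : Subst l m l′ m′) → M ▷ M′ → M ⟦ σ ⟧ ▷ M′ ⟦ σ ⟧
▷-⟦⟧ σ (red-μ {M} {N})  = ▷-contract right _ _
  (trans (≔-⟦⟧-comm M right N σ) (cong (_⟦ lift-μ σ ⟧) (sym (=ᵣ-≔ M N))))
▷-⟦⟧ σ (red-μ′ {M} {N}) = ▷-contract left _ _
  (trans (≔-⟦⟧-comm M left N σ) (cong (_⟦ lift-μ σ ⟧) (sym (=ₗ-≔ M N))))
▷-⟦⟧ σ (ξ-ƛ r)        = ξ-ƛ (▷-⟦⟧ _ r)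
▷-⟦⟧ σ (ξ-·ₗ r)       = ξ-·ₗ (▷-⟦⟧ σ r)
▷-⟦⟧ σ (ξ-·ᵣ r)       = ξ-·ᵣ (▷-⟦⟧ σ r)
▷-⟦⟧ σ (ξ-μ r)        = ξ-μ (▷-⟦⟧ _ r)
▷-⟦⟧ σ (ξ-⟨⟩ {α} r)   = ξ-⟨⟩ (▷-plug (frames σ α) (▷-⟦⟧ σ r))

▷*-⟦⟧ : ∀ {M M′ : Term l m} (σ : Subst l m l′ m′) → M ▷* M′ → M ⟦ σ ⟧ ▷* M′ ⟦ σ ⟧
▷*-⟦⟧ σ = gmap (_⟦ σ ⟧) (▷-⟦⟧ σ)

▷*-rename : ∀ (ρ : Fin l → Fin l′) (θ : Fin m → Fin m′) {M M′} →
            M ▷* M′ → rename ρ θ M ▷* rename ρ θ M′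
▷*-rename ρ θ r = subst₂ _▷*_ (⟦ren⟧ ρ θ _) (⟦ren⟧ ρ θ _) (▷*-⟦⟧ (ren ρ θ) r)

infix 4 _▷F*_

data _▷F*_ {l m} : List (Frame l m) → List (Frame l m) → Set where
  []  : [] ▷F* []
  _∷_ : ∀ {s N N′ fs fs′} → N ▷* N′ → fs ▷F* fs′ → (s , N) ∷ fs ▷F* (s , N′) ∷ fs′

▷F*-rename : ∀ (ρ : Fin l → Fin l′) (θ : Fin m → Fin m′) {fs fs′} →
             fs ▷F* fs′ → mapF (rename ρ θ) fs ▷F* mapF (rename ρ θ) fs′
▷F*-rename ρ θ []       = []
▷F*-rename ρ θ (r ∷ rs) = ▷*-rename ρ θ r ∷ ▷F*-rename ρ θ rs

▷*-plug : ∀ {M M′ : Term l m} {fs fs′} → M ▷* M′ → fs ▷F* fs′ → plug M fs ▷* plug M′ fs′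
▷*-plug r []                 = r
▷*-plug r (_∷_ {s = s} q qs) =
  ▷*-plug (gmap _ (▷-appˡ s) r ◅◅ gmap _ (▷-appʳ s) q) qs

-- A frame is copied to each subterm named by its variable, so one step in it may become any number
-- of steps, including none.
⟦⟧-▷F* : ∀ (M : Term l m) (σ : Subst l m l′ m′) {fs} → (∀ α → frames σ α ▷F* fs α) →
         M ⟦ σ ⟧ ▷* M ⟦ mkSubst (ren-λ σ) (ren-μ σ) fs ⟧
⟦⟧-▷F* (var x)   σ rs = ε
⟦⟧-▷F* (ƛ M)     σ rs = gmap ƛ_ ξ-ƛ (⟦⟧-▷F* M (lift-λ σ) (▷F*-rename suc id ∘ rs))
⟦⟧-▷F* (M · N)   σ rs =
  gmap (_· _) ξ-·ₗ (⟦⟧-▷F* M σ rs) ◅◅ gmap (_ ·_) ξ-·ᵣ (⟦⟧-▷F* N σ rs)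
⟦⟧-▷F* (μ M)     σ rs = gmap μ_ ξ-μ (⟦⟧-▷F* M (lift-μ σ)
  λ { zero → [] ; (suc α) → ▷F*-rename id suc (rs α) })
⟦⟧-▷F* (⟨ α ⟩ M) σ rs = gmap ⟨ _ ⟩_ ξ-⟨⟩ (▷*-plug (⟦⟧-▷F* M σ rs) (rs α))

≔-▷*ˡ : ∀ {M M′} {s} {N : Term l m} → M ▷* M′ → M [ s ≔ N ] ▷* M′ [ s ≔ N ]
≔-▷*ˡ = ▷*-⟦⟧ _

≔-▷*ʳ : ∀ M {s} {N N′ : Term l m} → N ▷* N′ → M [ s ≔ N ] ▷* M [ s ≔ N′ ]
≔-▷*ʳ M r = ⟦⟧-▷F* M _ λ { zero → ▷*-rename id suc r ∷ [] ; (suc _) → [] }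

-- Strong normalization of term constructors.

SN : Term l m → Set
SN = Acc (flip _▷_)

SN-▷* : ∀ {M M′ : Term l m} → SN M → M ▷* M′ → SN M′
SN-▷* a       ε        = a
SN-▷* (acc h) (r ◅ rs) = SN-▷* (h r) rs

SN-ƛ : ∀ {M : Term (suc l) m} → SN M → SN (ƛ M)
SN-ƛ (acc h) = acc λ { (ξ-ƛ r) → SN-ƛ (h r) }

SN-μ : ∀ {M : Term l (suc m)} → SN M → SN (μ M)
SN-μ (acc h) = acc λ { (ξ-μ r) → SN-μ (h r) }

SN-⟨⟩ : ∀ {α} {M : Term l m} → SN M → SN (⟨ α ⟩ M)
SN-⟨⟩ (acc h) = acc λ { (ξ-⟨⟩ r) → SN-⟨⟩ (h r) }

HeadSN : Side → Term l m → Term l m → Set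
HeadSN s M N = ∀ {P} → M ▷* μ P → SN (P [ s ≔ N ])

-- Induction on both components. `HeadSN` survives a step in the head because it ranges over all
-- reducts of the head, and a step in the argument because the contractum then reduces to the new
-- one.
SN-· : ∀ {M N : Term l m} → SN M → SN N →
       HeadSN right M N → HeadSN left N M → SN (M · N)
SN-· (acc h) (acc k) p q = acc λ
  { red-μ    → SN-μ (subst SN (sym (=ᵣ-≔ _ _)) (p ε))
  ; red-μ′   → SN-μ (subst SN (sym (=ₗ-≔ _ _)) (q ε))
  ; (ξ-·ₗ r) → SN-· (h r) (acc k) (λ rs → p (r ◅ rs))
                 (λ {P} rs → SN-▷* (q rs) (≔-▷*ʳ P (r ◅ ε)))
  ; (ξ-·ᵣ r) → SN-· (acc h) (k r)
                 (λ {P} rs → SN-▷* (p rs) (≔-▷*ʳ P (r ◅ ε))) (λ rs → q (r ◅ rs)) }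

-- Reductions that expose a head `μ`.

ƛ-▷*-μ : ∀ {M} {P : Term l (suc m)} → ¬ (ƛ M ▷* μ P)
ƛ-▷*-μ (ξ-ƛ _ ◅ rs) = ƛ-▷*-μ rs

⟨⟩-▷*-μ : ∀ {α M} {P : Term l (suc m)} → ¬ (⟨ α ⟩ M ▷* μ P)
⟨⟩-▷*-μ (ξ-⟨⟩ _ ◅ rs) = ⟨⟩-▷*-μ rs

μ-▷*-μ : ∀ {M P : Term l (suc m)} → μ M ▷* μ P → M ▷* P
μ-▷*-μ ε            = ε
μ-▷*-μ (ξ-μ r ◅ rs) = r ◅ μ-▷*-μ rs

HeadReduct : Side → Term l m → Term l m → Term l (suc m) → Set
HeadReduct s M N P = ∃[ Q ] M ▷* μ Q × Q [ s ≔ N ] ▷* P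

HeadReduct-▷ˡ : ∀ {s} {M M′ N : Term l m} {P} →
                M ▷ M′ → HeadReduct s M′ N P → HeadReduct s M N P
HeadReduct-▷ˡ r (Q , rs , qs) = Q , r ◅ rs , qs

HeadReduct-▷ʳ : ∀ {s} {M N N′ : Term l m} {P} →
                N ▷ N′ → HeadReduct s M N′ P → HeadReduct s M N P
HeadReduct-▷ʳ r (Q , rs , qs) = Q , rs , ≔-▷*ʳ Q (r ◅ ε) ◅◅ qs

-- An application becomes a `μ` only by a contraction at the root. Earlier steps lie in `M` or `N`
-- and are absorbed into the exposure of the head or into the argument of the contractum; later ones
-- stay below the `μ`.
·-▷*-μ : ∀ {M N : Term l m} {P} → M · N ▷* μ P →
         HeadReduct right M N P ⊎ HeadReduct left N M P
·-▷*-μ (red-μ  ◅ rs) = inj₁ (_ , ε , subst (_▷* _) (=ᵣ-≔ _ _) (μ-▷*-μ rs))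
·-▷*-μ (red-μ′ ◅ rs) = inj₂ (_ , ε , subst (_▷* _) (=ₗ-≔ _ _) (μ-▷*-μ rs))
·-▷*-μ (ξ-·ₗ r ◅ rs) = Sum.map (HeadReduct-▷ˡ r) (HeadReduct-▷ʳ r) (·-▷*-μ rs)
·-▷*-μ (ξ-·ᵣ r ◅ rs) = Sum.map (HeadReduct-▷ʳ r) (HeadReduct-▷ˡ r) (·-▷*-μ rs)

app-▷*-contract : ∀ s {M : Term l m} {N Q} → M ▷* μ Q → app s M N ▷* μ (Q [ s ≔ N ])
app-▷*-contract s rs = gmap _ (▷-appˡ s) rs ◅◅ ▷-contract s _ _ refl ◅ ε

-- A substitution inserts arguments only below a name, so it cannot create a head `μ`. For
-- applications, `≔-⟦⟧-comm` carries the reflected contraction back through `σ`.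
μ-reflect : ∀ M (σ : Subst l m l′ m′) {P} → M ⟦ σ ⟧ ▷* μ P →
            ∃[ Q ] M ▷* μ Q × Q ⟦ lift-μ σ ⟧ ▷* P
μ-reflect (ƛ M)     σ rs = contradiction rs ƛ-▷*-μ
μ-reflect (M · N)   σ rs with ·-▷*-μ rs
... | inj₁ (Q , qs , ps) with μ-reflect M σ qs
... | Q′ , rs′ , qs′ = _ , app-▷*-contract right rs′ ,
  subst (_▷* _) (≔-⟦⟧-comm Q′ right N σ) (≔-▷*ˡ qs′) ◅◅ ps
μ-reflect (M · N)   σ rs | inj₂ (Q , qs , ps) with μ-reflect N σ qs
... | Q′ , rs′ , qs′ = _ , app-▷*-contract left rs′ ,
  subst (_▷* _) (≔-⟦⟧-comm Q′ left M σ) (≔-▷*ˡ qs′) ◅◅ ps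
μ-reflect (μ M)     σ rs = M , ε , μ-▷*-μ rs
μ-reflect (⟨ α ⟩ M) σ rs = contradiction rs ⟨⟩-▷*-μ
μ-reflect (var x)   σ (() ◅ _)

-- The well-founded order on strongly normalizing terms.

-- Passing to a subterm changes the scope, so ≺ relates terms of arbitrary scopes.
record AnyTerm : Set where
  constructor any
  field
    {scope-λ scope-μ} : ℕ
    term              : Term scope-λ scope-μ

open AnyTerm

infix 4 _⋖_ _≺_

data _⋖_ : AnyTerm → AnyTerm → Set where
  reduct  : {M M′ : Term l m} → M ▷ M′ → any M′ ⋖ any M
  ƛ-body  : {M : Term (suc l) m} → any M ⋖ any (ƛ M)
  ·-left  : {M N : Term l m} → any M ⋖ any (M · N)
  ·-right : {M N : Term l m} → any N ⋖ any (M · N)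
  μ-body  : {M : Term l (suc m)} → any M ⋖ any (μ M)
  ⟨⟩-body : ∀ {α} {M : Term l m} → any M ⋖ any (⟨ α ⟩ M)

_≺_ : AnyTerm → AnyTerm → Set
_≺_ = TransClosure _⋖_

-- A step in a subterm lifts to a step of the whole, so the reducts of subterms of
-- M are subterms of reducts of M.
reducts-acc : (M : Term l m) → (∀ {M′} → M ▷ M′ → Acc _⋖_ (any M′)) → Acc _⋖_ (any M)
reducts-acc (var x)   h = acc λ { (reduct r) → h r }
reducts-acc (ƛ M)     h = acc λ
  { (reduct r) → h r
  ; ƛ-body     → reducts-acc M λ r → acc-inverse (h (ξ-ƛ r)) ƛ-body }
reducts-acc (M · N)   h = acc λ
  { (reduct r) → h r
  ; ·-left     → reducts-acc M λ r → acc-inverse (h (ξ-·ₗ r)) ·-left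
  ; ·-right    → reducts-acc N λ r → acc-inverse (h (ξ-·ᵣ r)) ·-right }
reducts-acc (μ M)     h = acc λ
  { (reduct r) → h r
  ; μ-body     → reducts-acc M λ r → acc-inverse (h (ξ-μ r)) μ-body }
reducts-acc (⟨ α ⟩ M) h = acc λ
  { (reduct r) → h r
  ; ⟨⟩-body    → reducts-acc M λ r → acc-inverse (h (ξ-⟨⟩ r)) ⟨⟩-body }

SN⇒acc-⋖ : {M : Term l m} → SN M → Acc _⋖_ (any M)
SN⇒acc-⋖ (acc h) = reducts-acc _ λ r → SN⇒acc-⋖ (h r)

SN⇒acc-≺ : {M : Term l m} → SN M → Acc _≺_ (any M)
SN⇒acc-≺ a = accessible _⋖_ (SN⇒acc-⋖ a)

≺-▷* : ∀ {W} {M M′ : Term l m} → W ≺ any M′ → M ▷* M′ → W ≺ any M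
≺-▷* p ε        = p
≺-▷* p (r ◅ rs) = ≺-▷* p rs ++⁺ [ reduct r ]

μ-body-≺ : ∀ {M : Term l m} {P} → M ▷* μ P → any P ≺ any M
μ-body-≺ = ≺-▷* [ μ-body ]

-- Compatible arguments and good substitutions.

data AtMostOne (s : Side) (C : Term l m → Set) : List (Frame l m) → Set where
  []  : AtMostOne s C []
  [_] : ∀ {N} → C N → AtMostOne s C ((s , N) ∷ [])

AtMostOne-map : ∀ {s} {C : Term l m → Set} {D : Term l′ m′ → Set} {f : Term l m → Term l′ m′} →
                (∀ {N} → C N → D (f N)) → ∀ {fs} → AtMostOne s C fs → AtMostOne s D (mapF f fs)
AtMostOne-map g []    = []
AtMostOne-map g [ c ] = [ g c ]

AtMostOne-⊆ : ∀ {s} {C D : Term l m → Set} →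
              (∀ {N} → C N → D N) → ∀ {fs} → AtMostOne s C fs → AtMostOne s D fs
AtMostOne-⊆ g []    = []
AtMostOne-⊆ g [ c ] = [ g c ]

-- X and U may live in different scopes, and X is closed under renaming so that it
-- can be pushed below binders.
Compatible : ∀ {U} → Side → Acc _≺_ U → Term l m → Set
Compatible {l} {m} {U} s (acc h) X =
  ∀ {W} (p : W ≺ U) {l′ m′} (σ : Subst (scope-λ W) (scope-μ W) l′ m′)
  (ρ : Fin l → Fin l′) (θ : Fin m → Fin m′) →
  (∀ α → AtMostOne s (Compatible s (h p)) (frames σ α)) →
  SN (app s (term W ⟦ σ ⟧) (rename ρ θ X))

Good : ∀ {U} → Side → Acc _≺_ U → Subst l m l′ m′ → Set
Good s a σ = ∀ α → AtMostOne s (Compatible s a) (frames σ α)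

-- Compatibility is defined by recursion on the accessibility proof, whose choice must not matter.
-- It occurs contravariantly in its own definition, so the recursive call exchanges the two proofs.
Compatible-irr : ∀ {U s} (a b : Acc _≺_ U) {X : Term l m} →
                 Compatible s a X → Compatible s b X
Compatible-irr (acc h) (acc k) c p σ ρ θ g =
  c p σ ρ θ λ α → AtMostOne-⊆ (Compatible-irr (k p) (h p)) (g α)

-- Terms below `W` are below `U`; this is where the transitivity of `≺` is used.
Compatible-≺ : ∀ {U W s} (a : Acc _≺_ U) (b : Acc _≺_ W) → W ≺ U → {X : Term l m} →
               Compatible s a X → Compatible s b X
Compatible-≺ (acc h) (acc k) p c q σ ρ θ g =
  c (q ++⁺ p) σ ρ θ λ α → AtMostOne-⊆ (Compatible-irr (k q) (h (q ++⁺ p))) (g α)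

Compatible-rename : ∀ {U s} (a : Acc _≺_ U) (ρ : Fin l → Fin l′) (θ : Fin m → Fin m′) →
                    {X : Term l m} → Compatible s a X → Compatible s a (rename ρ θ X)
Compatible-rename {s = s} (acc h) ρ θ {X} c {W} p σ ρ′ θ′ g =
  subst (λ K → SN (app s (term W ⟦ σ ⟧) K)) (sym (rename-rename ρ′ θ′ ρ θ X))
    (c p σ (ρ′ ∘ ρ) (θ′ ∘ θ) g)

Good-≺ : ∀ {U W s} (a : Acc _≺_ U) (b : Acc _≺_ W) → W ≺ U → (σ : Subst l m l′ m′) →
         Good s a σ → Good s b σ
Good-≺ a b p σ g α = AtMostOne-⊆ (Compatible-≺ a b p) (g α)

Good-⨾ : ∀ {U s} (a : Acc _≺_ U) (σ : Subst l m l′ m′)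
         (ρ : Fin l′ → Fin l″) (θ : Fin m′ → Fin m″) →
         Good s a σ → Good s a (σ ⨾ (ρ , θ))
Good-⨾ a σ ρ θ g α = AtMostOne-map (Compatible-rename a ρ θ) (g α)

Good-▸ : ∀ {U s} (a : Acc _≺_ U) {fs} (σ : Subst l m l′ m′) →
         AtMostOne s (Compatible s a) fs → Good s a σ → Good s a (fs ▸ σ)
Good-▸ a σ c g zero    = c
Good-▸ a σ c g (suc α) = AtMostOne-map (Compatible-rename a id suc) (g α)

-- With at most one frame per variable, a named term gives rise to a single application, which
-- compatibility controls.
SN-plug : ∀ {s} {C : Term l m → Set} {M fs} → AtMostOne s C fs →
          SN M → (∀ {N} → C N → SN (app s M N)) → SN (plug M fs)
SN-plug []    a f = a
SN-plug [ c ] a f = f c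

-- Strong normalization of instances and of their applications.

HeadSN-⟦⟧ : ∀ s M N (σ : Subst l m l′ m′) →
            (∀ {Q} → M ▷* μ Q → SN (Q [ s ≔ N ] ⟦ lift-μ σ ⟧)) → HeadSN s (M ⟦ σ ⟧) (N ⟦ σ ⟧)
HeadSN-⟦⟧ s M N σ f rs with μ-reflect M σ rs
... | Q , qs , ps = SN-▷* (subst SN (sym (≔-⟦⟧-comm Q s N σ)) (f qs)) (≔-▷*ˡ ps)

SN-⟦⟧ : ∀ {s} (M : Term l m) (a : Acc _≺_ (any M)) (σ : Subst l m l′ m′) →
        Good s a σ → SN (M ⟦ σ ⟧)
SN-⟦⟧ (var x)   a         σ g = acc λ ()
SN-⟦⟧ (ƛ M)     a@(acc h) σ g =
  -- `Good` inspects only frames, and `lift-λ σ` has the same frames as `σ ⨾ (suc , id)`.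
  SN-ƛ (SN-⟦⟧ M (h p) (lift-λ σ) (Good-⨾ (h p) σ suc id (Good-≺ a (h p) p σ g)))
  where p = [ ƛ-body ]
SN-⟦⟧ (μ M)     a@(acc h) σ g =
  SN-μ (SN-⟦⟧ M (h p) (lift-μ σ) (Good-▸ (h p) σ [] (Good-≺ a (h p) p σ g)))
  where p = [ μ-body ]
SN-⟦⟧ {s = s} (⟨ α ⟩ M) a@(acc h) σ g =
  SN-⟨⟩ (SN-plug (g α) (SN-⟦⟧ M (h p) σ g′) λ {N} c →
    -- Compatibility with the named term is used at its body `M`, with identity renamings of the
    -- argument.
    subst (λ K → SN (app s (M ⟦ σ ⟧) K)) (trans (sym (⟦ren⟧ id id N)) (⟦id⟧ N))
      (c p σ id id g′))
  where
  p  = [ ⟨⟩-body ]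
  g′ = Good-≺ a (h p) p σ g
SN-⟦⟧ {s = s} (M · N)   a@(acc h) σ g =
  SN-· (SN-⟦⟧ M (h [ ·-left ]) σ (Good-≺ a _ [ ·-left ] σ g))
       (SN-⟦⟧ N (h [ ·-right ]) σ (Good-≺ a _ [ ·-right ] σ g))
       -- The body of the contractum need not be below `M` or `N`, but `M · N` itself reduces to its
       -- `μ`, so it is below `M · N`.
       (HeadSN-⟦⟧ right M N σ λ rs → body (μ-body-≺ (app-▷*-contract right rs)))
       (HeadSN-⟦⟧ left N M σ λ rs → body (μ-body-≺ (app-▷*-contract left rs)))
  where
  body : ∀ {Q} → any Q ≺ any (M · N) → SN (Q ⟦ lift-μ σ ⟧)
  body {Q} p = SN-⟦⟧ Q (h p) (lift-μ σ) (Good-▸ (h p) σ [] (Good-≺ a (h p) p σ g))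

-- The exposed body `Q` is strictly below `U`, so `X` is compatible with `Q` too, and `σ` extended
-- by `X` is good for `Q`.
SN-μ-head : ∀ {U s} (a : Acc _≺_ (any U)) (σ : Subst l m l′ m′) {X} →
            Good s a σ → Compatible s a X → HeadSN s (U ⟦ σ ⟧) X
SN-μ-head {U = U} {s} a@(acc h) σ {X} g c rs with μ-reflect U σ rs
... | Q , qs , ps =
  SN-▷* (subst SN (sym (⟦⟧-≔ Q s X σ)) (SN-⟦⟧ Q b _ (Good-▸ b σ
    [ Compatible-rename b id suc (Compatible-≺ a b p c) ] (Good-≺ a b p σ g)))) (≔-▷*ˡ ps)
  where
  p = μ-body-≺ qs
  b = h p

SN-⟦⟧·⟦⟧ : ∀ {l₁ m₁ l₂ m₂} (U : Term l₁ m₁) (V : Term l₂ m₂)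
           (a : Acc _≺_ (any U)) (b : Acc _≺_ (any V))
           (σ : Subst l₁ m₁ l m) (τ : Subst l₂ m₂ l m) →
           Good right a σ → Good left b τ → SN (U ⟦ σ ⟧ · V ⟦ τ ⟧)
SN-⟦⟧·⟦⟧ U V a@(acc h) b@(acc k) σ τ g g′ =
  SN-· (SN-⟦⟧ U a σ g) (SN-⟦⟧ V b τ g′)
    (SN-μ-head a σ g λ {W} p υ ρ θ g″ →
      -- The renaming is absorbed into `τ`, so the argument is again an instance of `V` and the
      -- recursive call descends from `U` to `W`.
      subst (λ K → SN (term W ⟦ υ ⟧ · K)) (sym (rename-⟦⟧ʳ τ ρ θ V))
        (SN-⟦⟧·⟦⟧ (term W) V (h p) b υ (τ ⨾ (ρ , θ)) g″ (Good-⨾ b τ ρ θ g′)))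
    (SN-μ-head b τ g′ λ {W} p υ ρ θ g″ →
      subst (λ K → SN (K · term W ⟦ υ ⟧)) (sym (rename-⟦⟧ʳ σ ρ θ U))
        (SN-⟦⟧·⟦⟧ U (term W) a (k p) (σ ⨾ (ρ , θ)) υ (Good-⨾ a σ ρ θ g) g″))

-- Strong normalization of all terms.

strongly-normalizing : (M : Term l m) → SN M
strongly-normalizing (var x)   = acc λ ()
strongly-normalizing (ƛ M)     = SN-ƛ (strongly-normalizing M)
strongly-normalizing (μ M)     = SN-μ (strongly-normalizing M)
strongly-normalizing (⟨ α ⟩ M) = SN-⟨⟩ (strongly-normalizing M)
strongly-normalizing (M · N)   = subst₂ (λ K L → SN (K · L)) (⟦id⟧ M) (⟦id⟧ N)
  (SN-⟦⟧·⟦⟧ M N (SN⇒acc-≺ (strongly-normalizing M)) (SN⇒acc-≺ (strongly-normalizing N))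
    idS idS (λ _ → []) (λ _ → []))

acc⇒no-descent : {A : Set} {_<_ : A → A → Set} {x : A} → Acc _<_ x →
                 ¬ (∃[ f ] InfiniteDescendingSequenceFrom _<_ f x)
acc⇒no-descent (acc h) (f , refl , d) = acc⇒no-descent (h (d 0)) (f ∘ suc , refl , d ∘ suc)

theorem4p6 : ∀ (l m : ℕ) →
    StronglyNormalizing (_▷_ {l} {m}) ×
    (∀ (M : Term l m) → ¬ (∃[ f ] InfiniteDescendingSequenceFrom (flip _▷_) f M))
theorem4p6 l m = strongly-normalizing , λ M → acc⇒no-descent (strongly-normalizing M)
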